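{- Let $\ell\ge 2$ and $m\ge\max\{2\ell-2,4\}$ be integers. Then the binary hypercube of dimension $m$ belongs to $\mathfrak{Gr}(2^m,\,2^m-m+2\ell-2,\,\ell)$.
   Context: All graphs are finite, simple and undirected. The binary hypercube of dimension $m$ has vertex set $\{0,1\}^m$, two vertices being adjacent if and only if they differ in exactly one coordinate. For a graph $G=(V,E)$ and $x\in V$, $N[x]=\{x\}\cup\{y: xy\in E\}$; for $X\subseteq V$, $N[X]=\bigcup_{x\in X}N[x]$ (so $N[\emptyset]=\emptyset$). A set $C\subseteq V$ is $(1,\le\ell)$-identifying if $N[X]\cap C\neq N[Y]\cap C$ for all distinct $X,Y\subseteq V$ with $|X|\le\ell$, $|Y|\le\ell$. For $n\ge k\ge1$ and $\ell\ge1$, $\mathfrak{Gr}(n,k,\ell)$ is the set of graphs on $n$ vertices in which every $k$-element subset of vertices is $(1,\le\ell)$-identifying. -}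

module Defs where

open import Data.Nat using (ℕ; zero; suc; _+_; _≡ᵇ_; _%_; _/_)
open import Data.Bool using (Bool; true; false; if_then_else_)
open import Data.Fin using (Fin; toℕ)
open import Data.Fin.Subset using (Subset; _∈_; ∣_∣)
open import Data.Vec using (Vec; []; _∷_)
open import Data.Product using (∃; _×_)
open import Data.Sum using (_⊎_)
open import Relation.Binary.PropositionalEquality using (_≡_; _≢_)
open import Relation.Nullary using (¬_)
open import Function.Bundles using (_⇔_)

Graph : ℕ → Set₁
Graph n = Fin n → Fin n → Set

_∈N[_]_ : {n : ℕ} → Fin n → Graph n → Subset n → Set
y ∈N[ G ] X = ∃ λ x → x ∈ X × (x ≡ y ⊎ G x y)

Identifying : {n : ℕ} → Graph n → ℕ → Subset n → Set
Identifying {n} G ℓ C =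
  (X Y : Subset n) → ∣ X ∣ Data.Nat.≤ ℓ → ∣ Y ∣ Data.Nat.≤ ℓ → X ≢ Y →
  ¬ ((y : Fin n) → y ∈ C → ((y ∈N[ G ] X) ⇔ (y ∈N[ G ] Y)))

InGr : (n k ℓ : ℕ) → Graph n → Set
InGr n k ℓ G = (C : Subset n) → ∣ C ∣ ≡ k → Identifying G ℓ C

bits : ℕ → (m : ℕ) → Vec Bool m
bits a zero = []
bits a (suc m) = (a % 2 ≡ᵇ 1) ∷ bits (a / 2) m

hamming : {m : ℕ} → Vec Bool m → Vec Bool m → ℕ
hamming [] [] = 0
hamming (x ∷ xs) (y ∷ ys) = (if x Data.Bool.xor y then 1 else 0) + hamming xs ys

-- binary hypercube of dimension m; vertex i ∈ Fin (2^m) is identified with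
-- the binary expansion of i, a bijection Fin (2^m) ≅ {0,1}^m
Hypercube : (m : ℕ) → Graph (2 Data.Nat.^ m)
Hypercube m i j = hamming (bits (toℕ i) m) (bits (toℕ j) m) ≡ 1

{-# OPTIONS --safe #-}
-- Let D be the complement of C, so |D| = m − 2ℓ + 2, and suppose that N[X] and N[Y] agree outside D.
-- For x ∈ X ∖ Y, each of the m + 1 points of N[x] lies in D or in some N[y], y ∈ Y, and |N[x] ∩ N[y]| ≤ 2; since
-- |D| + 2ℓ = m + 2, this count has only one unit of slack. Hence |Y| = ℓ, all of Y is within distance 2 of x,
-- and no word of Y is within distance 2 of two others, because if d(y, y′) ≤ 2, then N[x], N[y] and N[y′] share
-- the median of x, y, y′.
-- So Y ∖ X is nonempty too, and X and Y play symmetric roles.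
-- If ℓ ≥ 3, then X and Y are disjoint, some two x₁, x₂ ∈ X are at distance ≥ 3, and some y₁ ∈ Y is at distance ≥ 3
-- from two distinct y₂, y₃ ∈ Y; both must be the corner y₁ + x₁ + x₂ opposite to y₁ in a rectangle.
-- If ℓ = 2, then counting the uncovered points of two or three disjoint balls against |D| = m − 2 contradicts m ≥ 4.

module Submission where

open import Defs
open import Data.Nat using (ℕ; _≤_; _⊔_; _^_; _∸_; _+_; _*_;
  zero; suc; _<_; z≤n; s≤s; _≡ᵇ_; _%_; _/_; _≤?_)
open import Data.Nat.Properties hiding (_≟_; suc-injective)
open import Data.Nat.DivMod
open import Data.Nat.Divisibility using (divides-refl)
open import Data.Nat.Tactic.RingSolver using (solve-∀)
open import Data.Bool using (Bool; true; false; not; _xor_; if_then_else_)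
open import Data.Bool.Properties using () renaming (_≟_ to _≟ᵇ_)
open import Data.Fin using (Fin; zero; suc; toℕ; fromℕ<)
open import Data.Fin.Properties using (toℕ<n; toℕ-fromℕ<; toℕ-injective; suc-injective)
open import Data.Fin.Subset using (Subset; ∣_∣; ∁) renaming (_∈_ to _∈ₛ_)
open import Data.Fin.Subset.Properties using (⊆-antisym; ∣∁p∣≡n∸∣p∣; x∉p⇒x∈∁p) renaming (_∈?_ to _∈ₛ?_)
open import Data.Vec using (Vec; []; _∷_; zipWith; here; there)
open import Data.Vec.Properties using (≡-dec; ∷-injectiveʳ)
open import Data.List using (List; []; _∷_; [_]; _++_; map; length; filter; concatMap)
open import Data.List.Properties using (length-++; length-map; filter-notAll)
open import Data.List.Membership.Propositional using (_∈_; _∉_; find; lose)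
open import Data.List.Membership.Propositional.Properties using
  (∈-map⁺; ∈-map⁻; ∈-++⁺ˡ; ∈-++⁺ʳ; ∈-++⁻; ∈-concatMap⁺; ∈-filter⁺; ∈-filter⁻)
open import Data.List.Relation.Binary.Subset.Propositional using (_⊆_)
open import Data.List.Relation.Unary.Any using (Any; here; there; any?)
open import Data.List.Relation.Unary.All using ([]; _∷_) renaming (lookup to lookupAll; tabulate to tabulateAll)
open import Data.List.Relation.Unary.All.Properties using (¬All⇒Any¬)
open import Data.List.Relation.Unary.AllPairs using ([]; _∷_)
open import Data.List.Relation.Unary.Unique.Propositional using (Unique)
import Data.List.Relation.Unary.Unique.Propositional.Properties as Uniqueₚ
open import Data.List.Relation.Binary.Disjoint.Propositional using (Disjoint)
open import Data.Product using (∃; _×_; _,_; proj₁; proj₂)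
open import Data.Sum using (_⊎_; inj₁; inj₂)
open import Data.Empty using (⊥)
open import Function using (_∘_)
open import Function.Bundles using (Equivalence)
open import Relation.Nullary using (¬_; Dec; yes; no; ¬?)
open import Relation.Nullary.Decidable using (decidable-stable)
open import Relation.Nullary.Negation using (contradiction)
open import Relation.Binary.Definitions using (DecidableEquality)
open import Relation.Binary.PropositionalEquality hiding ([_])
open import Algebra.Properties.CommutativeSemigroup +-commutativeSemigroup using (interchange)

-- Pigeonhole for duplicate-free lists

module _ {a} {A : Set a} (_≟_ : DecidableEquality A) where

  open import Data.List.Membership.DecPropositional _≟_ using (_∈?_)

  remove : A → List A → List A
  remove x = filter (λ y → ¬? (y ≟ x))

  length-remove : ∀ {x xs} → x ∈ xs → length (remove x xs) < length xs
  length-remove x∈xs = filter-notAll _ _ (lose x∈xs (λ x≢x → x≢x refl))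

  unique-⊆⇒length≤ : ∀ {xs ys} → Unique xs → xs ⊆ ys → length xs ≤ length ys
  unique-⊆⇒length≤ {[]} _ _ = z≤n
  unique-⊆⇒length≤ {x ∷ xs} {ys} (x∉xs ∷ uxs) xs⊆ys =
    ≤-trans (s≤s (unique-⊆⇒length≤ uxs xs⊆ys-x)) (length-remove (xs⊆ys (here refl)))
    where
    xs⊆ys-x : xs ⊆ remove x ys
    xs⊆ys-x v∈xs = ∈-filter⁺ _ (xs⊆ys (there v∈xs)) (λ v≡x → lookupAll x∉xs v∈xs (sym v≡x))

  ∃-fresh : ∀ {xs ys} → Unique ys → length xs < length ys → ∃ λ y → y ∈ ys × y ∉ xs
  ∃-fresh {xs} {ys} uys xs<ys = find (¬All⇒Any¬ (_∈? xs) ys λ ys⊆xs →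
    <⇒≱ xs<ys (unique-⊆⇒length≤ uys (lookupAll ys⊆xs)))

length-concatMap : ∀ {a b} {A : Set a} {B : Set b} (f : A → List B) {k} →
  (∀ x → length (f x) ≤ k) → ∀ xs → length (concatMap f xs) ≤ length xs * k
length-concatMap f fx≤k [] = z≤n
length-concatMap f {k} fx≤k (x ∷ xs) = begin
  length (f x ++ concatMap f xs)          ≡⟨ length-++ (f x) ⟩
  length (f x) + length (concatMap f xs)  ≤⟨ +-mono-≤ (fx≤k x) (length-concatMap f fx≤k xs) ⟩
  k + length xs * k                       ∎
  where open ≤-Reasoning

-- The Hamming metric on binary words

Word : ℕ → Set
Word = Vec Bool

_≟_ : ∀ {m} → DecidableEquality (Word m)
_≟_ = ≡-dec _≟ᵇ_

private
  δ : Bool → Bool → ℕ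
  δ a b = if a xor b then 1 else 0

hamming-refl : ∀ {m} (x : Word m) → hamming x x ≡ 0
hamming-refl []          = refl
hamming-refl (false ∷ x) = hamming-refl x
hamming-refl (true ∷ x)  = hamming-refl x

hamming≡0⇒≡ : ∀ {m} (x y : Word m) → hamming x y ≡ 0 → x ≡ y
hamming≡0⇒≡ [] [] _ = refl
hamming≡0⇒≡ (false ∷ x) (false ∷ y) p = cong (false ∷_) (hamming≡0⇒≡ x y p)
hamming≡0⇒≡ (true ∷ x)  (true ∷ y)  p = cong (true ∷_) (hamming≡0⇒≡ x y p)

hamming≤0⇒≡ : ∀ {m} {x y : Word m} → hamming x y ≤ 0 → x ≡ y
hamming≤0⇒≡ p = hamming≡0⇒≡ _ _ (n≤0⇒n≡0 p)

hamming-sym : ∀ {m} (x y : Word m) → hamming x y ≡ hamming y x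
hamming-sym [] [] = refl
hamming-sym (a ∷ x) (b ∷ y) = cong₂ _+_ (pointwise a b) (hamming-sym x y)
  where
  pointwise : ∀ a b → δ a b ≡ δ b a
  pointwise false false = refl
  pointwise false true  = refl
  pointwise true  false = refl
  pointwise true  true  = refl

hamming-triangle : ∀ {m} (x y z : Word m) → hamming x z ≤ hamming x y + hamming y z
hamming-triangle [] [] [] = z≤n
hamming-triangle (a ∷ x) (b ∷ y) (c ∷ z) = begin
  δ a c + hamming x z                              ≤⟨ +-mono-≤ (pointwise a b c) (hamming-triangle x y z) ⟩
  (δ a b + δ b c) + (hamming x y + hamming y z)    ≡⟨ interchange (δ a b) (δ b c) (hamming x y) (hamming y z) ⟩
  (δ a b + hamming x y) + (δ b c + hamming y z)    ∎
  where
  open ≤-Reasoning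
  pointwise : ∀ a b c → δ a c ≤ δ a b + δ b c
  pointwise false b     false = z≤n
  pointwise true  b     true  = z≤n
  pointwise false false true  = s≤s z≤n
  pointwise false true  true  = s≤s z≤n
  pointwise true  false false = s≤s z≤n
  pointwise true  true  false = s≤s z≤n

-- Medians, parity and common neighbours

majority : Bool → Bool → Bool → Bool
majority false false _ = false
majority false true  c = c
majority true  false c = c
majority true  true  _ = true

median : ∀ {m} → Word m → Word m → Word m → Word m
median [] [] [] = []
median (a ∷ x) (b ∷ y) (c ∷ z) = majority a b c ∷ median x y z

-- The median lies on a geodesic between any two of the three words. If `p`, `q`, `r` are its
-- distances to `x`, `y`, `z`, the pairwise distances are therefore p + q, p + r and q + r.
median-between₁₂ : ∀ {m} (x y z : Word m) →
  hamming x (median x y z) + hamming y (median x y z) ≡ hamming x y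
median-between₁₂ [] [] [] = refl
median-between₁₂ (a ∷ x) (b ∷ y) (c ∷ z) =
  trans (interchange (δ a _) _ (δ b _) _) (cong₂ _+_ (pointwise a b c) (median-between₁₂ x y z))
  where
  pointwise : ∀ a b c → δ a (majority a b c) + δ b (majority a b c) ≡ δ a b
  pointwise false false c     = refl
  pointwise false true  false = refl
  pointwise false true  true  = refl
  pointwise true  false false = refl
  pointwise true  false true  = refl
  pointwise true  true  c     = refl

median-between₁₃ : ∀ {m} (x y z : Word m) →
  hamming x (median x y z) + hamming z (median x y z) ≡ hamming x z
median-between₁₃ [] [] [] = refl
median-between₁₃ (a ∷ x) (b ∷ y) (c ∷ z) =
  trans (interchange (δ a _) _ (δ c _) _) (cong₂ _+_ (pointwise a b c) (median-between₁₃ x y z))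
  where
  pointwise : ∀ a b c → δ a (majority a b c) + δ c (majority a b c) ≡ δ a c
  pointwise false false false = refl
  pointwise false false true  = refl
  pointwise false true  false = refl
  pointwise false true  true  = refl
  pointwise true  false false = refl
  pointwise true  false true  = refl
  pointwise true  true  false = refl
  pointwise true  true  true  = refl

median-between₂₃ : ∀ {m} (x y z : Word m) →
  hamming y (median x y z) + hamming z (median x y z) ≡ hamming y z
median-between₂₃ [] [] [] = refl
median-between₂₃ (a ∷ x) (b ∷ y) (c ∷ z) =
  trans (interchange (δ b _) _ (δ c _) _) (cong₂ _+_ (pointwise a b c) (median-between₂₃ x y z))
  where
  pointwise : ∀ a b c → δ b (majority a b c) + δ c (majority a b c) ≡ δ b c
  pointwise false false false = refl
  pointwise false false true  = refl
  pointwise false true  false = refl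
  pointwise false true  true  = refl
  pointwise true  false false = refl
  pointwise true  false true  = refl
  pointwise true  true  false = refl
  pointwise true  true  true  = refl

-- This is the bipartiteness of the hypercube, read off from the median: each of its three distances
-- enters two of the sides.
perimeter-even : ∀ {m} (x y z : Word m) → ∃ λ k →
  hamming x y + hamming x z + hamming y z ≡ 2 * k
perimeter-even x y z = p + q + r , (begin
  hamming x y + hamming x z + hamming y z ≡⟨ cong₂ _+_ (cong₂ _+_ (median-between₁₂ x y z) (median-between₁₃ x y z)) (median-between₂₃ x y z) ⟨
  (p + q) + (p + r) + (q + r)             ≡⟨ solve p q r ⟩
  2 * (p + q + r)                         ∎)
  where
  open ≡-Reasoning
  p = hamming x (median x y z)
  q = hamming y (median x y z)
  r = hamming z (median x y z)
  solve : ∀ p q r → (p + q) + (p + r) + (q + r) ≡ 2 * (p + q + r)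
  solve = solve-∀

private
  ≤1-of-sums : ∀ p q r → p + q ≤ 2 → p + r ≤ 2 → 0 < q + r → p ≤ 1
  ≤1-of-sums zero q r _ _ _ = z≤n
  ≤1-of-sums (suc zero) q r _ _ _ = s≤s z≤n
  ≤1-of-sums (suc (suc p)) zero (suc r) _ (s≤s (s≤s h)) _ = contradiction (≤-trans (m≤n+m (suc r) p) h) λ ()
  ≤1-of-sums (suc (suc p)) (suc q) r (s≤s (s≤s h)) _ _ = contradiction (≤-trans (m≤n+m (suc q) p) h) λ ()

≢⇒0<hamming : ∀ {m} {x y : Word m} → x ≢ y → 0 < hamming x y
≢⇒0<hamming x≢y = n≢0⇒n>0 (x≢y ∘ hamming≡0⇒≡ _ _)

Close : ∀ {m} → Word m → Word m → Set
Close x y = hamming x y ≤ 2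

close-sym : ∀ {m} (x y : Word m) → Close x y → Close y x
close-sym x y = subst (_≤ 2) (hamming-sym x y)

-- The median is such a point. Were it at distance 2 or more from one of the words, it would be at
-- distance 0 from the other two, which are distinct.
∃-common-neighbour : ∀ {m} {x y z : Word m} → x ≢ y → x ≢ z → y ≢ z →
  Close x y → Close x z → Close y z →
  ∃ λ w → hamming x w ≤ 1 × hamming y w ≤ 1 × hamming z w ≤ 1
∃-common-neighbour {x = x} {y} {z} x≢y x≢z y≢z xy xz yz =
  median x y z ,
  ≤1-of-sums p q r pq≤2 pr≤2 (subst (0 <_) (sym (median-between₂₃ x y z)) (≢⇒0<hamming y≢z)) ,
  ≤1-of-sums q p r (subst (_≤ 2) (+-comm p q) pq≤2) qr≤2
    (subst (0 <_) (sym (median-between₁₃ x y z)) (≢⇒0<hamming x≢z)) ,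
  ≤1-of-sums r p q (subst (_≤ 2) (+-comm p r) pr≤2) (subst (_≤ 2) (+-comm q r) qr≤2)
    (subst (0 <_) (sym (median-between₁₂ x y z)) (≢⇒0<hamming x≢y))
  where
  p = hamming x (median x y z)
  q = hamming y (median x y z)
  r = hamming z (median x y z)
  pq≤2 = subst (_≤ 2) (sym (median-between₁₂ x y z)) xy
  pr≤2 = subst (_≤ 2) (sym (median-between₁₃ x y z)) xz
  qr≤2 = subst (_≤ 2) (sym (median-between₂₃ x y z)) yz

-- Quadrilaterals with short sides and long diagonals

_⊕_ : ∀ {m} → Word m → Word m → Word m
_⊕_ = zipWith _xor_

-- Both sides are sums over the coordinates, so the 16 patterns of single bits suffice. On the right
-- stand the four sides of the quadrilateral x, y, x′, y′. On the left stand its diagonals and the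
-- distance from `x′` to the word that would complete a parallelogram.
quadrilateral : ∀ {m} (x x′ y y′ : Word m) →
  hamming x x′ + hamming y y′ + hamming x′ (x ⊕ (y ⊕ y′)) ≤
  (hamming x y + hamming x y′) + (hamming x′ y + hamming x′ y′)
quadrilateral [] [] [] [] = z≤n
quadrilateral (a ∷ x) (a′ ∷ x′) (b ∷ y) (b′ ∷ y′) =
  subst₂ _≤_ (sumₗ (δ a a′) (δ b b′) (δ a′ (a xor (b xor b′))) _ _ _)
             (sumᵣ (δ a b) (δ a b′) (δ a′ b) (δ a′ b′) _ _ _ _)
    (+-mono-≤ (pointwise a a′ b b′) (quadrilateral x x′ y y′))
  where
  sumₗ : ∀ a b c x y z → (a + b + c) + (x + y + z) ≡ (a + x) + (b + y) + (c + z)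
  sumₗ = solve-∀
  sumᵣ : ∀ a b c d x y z w → ((a + b) + (c + d)) + ((x + y) + (z + w)) ≡ ((a + x) + (b + y)) + ((c + z) + (d + w))
  sumᵣ = solve-∀
  pointwise : ∀ a a′ b b′ → δ a a′ + δ b b′ + δ a′ (a xor (b xor b′)) ≤ (δ a b + δ a b′) + (δ a′ b + δ a′ b′)
  pointwise false false false false = z≤n
  pointwise false false false true  = ≤-refl
  pointwise false false true  false = ≤-refl
  pointwise false false true  true  = z≤n
  pointwise false true  false false = ≤-refl
  pointwise false true  false true  = ≤-refl
  pointwise false true  true  false = ≤-refl
  pointwise false true  true  true  = ≤-refl
  pointwise true  false false false = ≤-refl
  pointwise true  false false true  = ≤-refl
  pointwise true  false true  false = ≤-refl
  pointwise true  false true  true  = ≤-refl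
  pointwise true  true  false false = z≤n
  pointwise true  true  false true  = ≤-refl
  pointwise true  true  true  false = ≤-refl
  pointwise true  true  true  true  = z≤n

private
  odd≢even : ∀ k → 7 ≢ 2 * k
  -- For `k` below 4 the equation is between distinct numerals, so these cases are absurd; from 4 on
  -- the right side is at least 8.
  odd≢even (suc (suc (suc (suc k)))) e = contradiction (m≤m+n 8 (2 * k)) (<⇒≱ (≤-reflexive (cong suc (trans (solve k) (sym e)))))
    where
    solve : ∀ k → 8 + 2 * k ≡ 2 * (4 + k)
    solve = solve-∀

  -- Only p + q = 4 has to be excluded, and it would give the odd perimeter 7.
  ≤3-of-even : ∀ {p q} k → p ≤ 2 → q ≤ 2 → p + q + 3 ≡ 2 * k → p + q ≤ 3
  ≤3-of-even {p} {q} k p≤2 q≤2 e with p + q ≤? 3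
  ... | yes h = h
  ... | no  h = contradiction
    (trans (cong (_+ 3) (≤-antisym (≰⇒> h) (+-mono-≤ p≤2 q≤2))) e) (odd≢even k)

-- quadrilateral leaves at most 8 − 6 = 2 for the distance in question; parity of perimeters removes this rest.
opposite-corner : ∀ {m} {x x′ y y′ : Word m} →
  Close x y → Close x y′ → Close x′ y → Close x′ y′ →
  ¬ Close x x′ → ¬ Close y y′ → x′ ≡ x ⊕ (y ⊕ y′)
opposite-corner {x = x} {x′} {y} {y′} xy xy′ x′y x′y′ ¬xx′ ¬yy′ =
  hamming≤0⇒≡ (≤0 (m≤n⇒m<n∨m≡n (≰⇒> ¬xx′)) (m≤n⇒m<n∨m≡n (≰⇒> ¬yy′)))
  where
  e = hamming x′ (x ⊕ (y ⊕ y′))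
  quad = quadrilateral x x′ y y′

  conclude : ∀ k → k ≤ hamming x x′ + hamming y y′ →
    (hamming x y + hamming x y′) + (hamming x′ y + hamming x′ y′) ≤ k → e ≤ 0
  conclude k lower upper = +-cancelˡ-≤ k _ _ (begin
    k + e                                ≤⟨ +-monoˡ-≤ e lower ⟩
    hamming x x′ + hamming y y′ + e      ≤⟨ quad ⟩
    _                                    ≤⟨ upper ⟩
    k                                    ≡⟨ +-identityʳ k ⟨
    k + 0                                ∎)
    where open ≤-Reasoning

  through-x : ∀ u → Close u y → Close u y′ → 3 ≡ hamming y y′ → hamming u y + hamming u y′ ≤ 3
  through-x u uy uy′ e₃ = ≤3-of-even (proj₁ (perimeter-even u y y′)) uy uy′
    (trans (cong (hamming u y + hamming u y′ +_) e₃) (proj₂ (perimeter-even u y y′)))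

  through-y : ∀ v → Close x v → Close x′ v → 3 ≡ hamming x x′ → hamming x v + hamming x′ v ≤ 3
  through-y v xv x′v e₃ = ≤3-of-even k xv x′v (begin
    hamming x v + hamming x′ v + 3             ≡⟨ cong (hamming x v + hamming x′ v +_) e₃ ⟩
    hamming x v + hamming x′ v + hamming x x′  ≡⟨ solve (hamming x v) (hamming x′ v) (hamming x x′) ⟩
    hamming x x′ + hamming x v + hamming x′ v  ≡⟨ proj₂ (perimeter-even x x′ v) ⟩
    2 * k                                      ∎)
    where
    open ≡-Reasoning
    k = proj₁ (perimeter-even x x′ v)
    solve : ∀ a b c → a + b + c ≡ c + a + b
    solve = solve-∀

  ≤0 : 3 < hamming x x′ ⊎ 3 ≡ hamming x x′ → 3 < hamming y y′ ⊎ 3 ≡ hamming y y′ → e ≤ 0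
  -- Two diagonals of length at least 4 sum to at least 8, the most that the four sides allow. If
  -- one diagonal is exactly 3, parity bounds the two sides at each end of the other one by 3
  -- together, and both totals are compared with 6.
  ≤0 (inj₁ p) (inj₁ q) = conclude 8 (+-mono-≤ p q) (+-mono-≤ (+-mono-≤ xy xy′) (+-mono-≤ x′y x′y′))
  ≤0 _ (inj₂ q) = conclude 6 (+-mono-≤ (≰⇒> ¬xx′) (≰⇒> ¬yy′))
    (+-mono-≤ (through-x x xy xy′ q) (through-x x′ x′y x′y′ q))
  ≤0 (inj₂ p) (inj₁ _) = conclude 6 (+-mono-≤ (≰⇒> ¬xx′) (≰⇒> ¬yy′))
    (≤-trans (≤-reflexive (interchange (hamming x y) _ (hamming x′ y) _))
      (+-mono-≤ (through-y y xy x′y p) (through-y y′ xy′ x′y′ p)))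

-- Balls of radius 1 and their intersections

neighbours : ∀ {m} → Word m → List (Word m)
neighbours []      = []
neighbours (b ∷ x) = (not b ∷ x) ∷ map (b ∷_) (neighbours x)

ball : ∀ {m} → Word m → List (Word m)
ball x = x ∷ neighbours x

length-ball : ∀ {m} (x : Word m) → length (ball x) ≡ suc m
length-ball []      = refl
length-ball (b ∷ x) = cong suc (trans (cong suc (length-map (b ∷_) (neighbours x))) (length-ball x))

∈-neighbours⇒hamming≡1 : ∀ {m} (x : Word m) {v} → v ∈ neighbours x → hamming x v ≡ 1
∈-neighbours⇒hamming≡1 (false ∷ x) (here refl) = cong suc (hamming-refl x)
∈-neighbours⇒hamming≡1 (true ∷ x)  (here refl) = cong suc (hamming-refl x)
∈-neighbours⇒hamming≡1 (b ∷ x) (there v∈) with ∈-map⁻ (b ∷_) v∈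
∈-neighbours⇒hamming≡1 (false ∷ x) (there _) | _ , u∈ , refl = ∈-neighbours⇒hamming≡1 x u∈
∈-neighbours⇒hamming≡1 (true ∷ x)  (there _) | _ , u∈ , refl = ∈-neighbours⇒hamming≡1 x u∈

∈-ball⇒hamming≤1 : ∀ {m} {x v : Word m} → v ∈ ball x → hamming x v ≤ 1
∈-ball⇒hamming≤1 {x = x} (here refl) = ≤-trans (≤-reflexive (hamming-refl x)) z≤n
∈-ball⇒hamming≤1 {x = x} (there v∈)  = ≤-reflexive (∈-neighbours⇒hamming≡1 x v∈)

neighbours-unique : ∀ {m} (x : Word m) → Unique (neighbours x)
neighbours-unique []      = []
neighbours-unique (b ∷ x) =
  tabulateAll (λ v∈ eq → differ b (∈-map⁻ (b ∷_) v∈) eq) ∷ Uniqueₚ.map⁺ ∷-injectiveʳ (neighbours-unique x)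
  where
  differ : ∀ b {v} → (∃ λ u → u ∈ neighbours x × v ≡ b ∷ u) → (not b ∷ x) ≢ v
  differ false (_ , _ , refl) ()
  differ true  (_ , _ , refl) ()

ball-unique : ∀ {m} (x : Word m) → Unique (ball x)
ball-unique x = tabulateAll x≢ ∷ neighbours-unique x
  where
  x≢ : ∀ {v} → v ∈ neighbours x → x ≢ v
  x≢ v∈ refl = contradiction (trans (sym (hamming-refl x)) (∈-neighbours⇒hamming≡1 x v∈)) λ ()

-- For distinct x and y, contains the intersection of the two balls (with equality up to distance 2; junk beyond).
meet : ∀ {m} → Word m → Word m → List (Word m)
meet [] [] = []
meet (false ∷ x) (false ∷ y) = map (false ∷_) (meet x y)
meet (false ∷ x) (true ∷ y)  = (true ∷ x) ∷ (false ∷ y) ∷ []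
meet (true ∷ x)  (false ∷ y) = (false ∷ x) ∷ (true ∷ y) ∷ []
meet (true ∷ x)  (true ∷ y)  = map (true ∷_) (meet x y)

length-meet : ∀ {m} (x y : Word m) → length (meet x y) ≤ 2
length-meet [] [] = z≤n
length-meet (false ∷ x) (false ∷ y) = ≤-trans (≤-reflexive (length-map _ (meet x y))) (length-meet x y)
length-meet (false ∷ x) (true ∷ y)  = ≤-refl
length-meet (true ∷ x)  (false ∷ y) = ≤-refl
length-meet (true ∷ x)  (true ∷ y)  = ≤-trans (≤-reflexive (length-map _ (meet x y))) (length-meet x y)

-- If `x` and `y` start with the same bit, so does `v`: otherwise its one permitted difference is
-- used up and both tails equal that of `v`, making `x` and `y` equal. If their first bits differ,
-- `v` differs from one of them there and shares its tail, which leaves two candidates.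
∈-meet : ∀ {m} {x y v : Word m} → x ≢ y → hamming x v ≤ 1 → hamming y v ≤ 1 → v ∈ meet x y
∈-meet {x = []} {[]} {[]} x≢y _ _ = contradiction refl x≢y
∈-meet {x = false ∷ x} {false ∷ y} {false ∷ v} x≢y p q = ∈-map⁺ _ (∈-meet (x≢y ∘ cong (false ∷_)) p q)
∈-meet {x = true ∷ x}  {true ∷ y}  {true ∷ v}  x≢y p q = ∈-map⁺ _ (∈-meet (x≢y ∘ cong (true ∷_)) p q)
∈-meet {x = false ∷ x} {false ∷ y} {true ∷ v}  x≢y (s≤s p) (s≤s q) =
  contradiction (cong (false ∷_) (trans (hamming≤0⇒≡ p) (sym (hamming≤0⇒≡ q)))) x≢y
∈-meet {x = true ∷ x}  {true ∷ y}  {false ∷ v} x≢y (s≤s p) (s≤s q) =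
  contradiction (cong (true ∷_) (trans (hamming≤0⇒≡ p) (sym (hamming≤0⇒≡ q)))) x≢y
∈-meet {x = false ∷ x} {true ∷ y}  {false ∷ v} _ p (s≤s q) = there (here (cong (false ∷_) (sym (hamming≤0⇒≡ q))))
∈-meet {x = false ∷ x} {true ∷ y}  {true ∷ v}  _ (s≤s p) q = here (cong (true ∷_) (sym (hamming≤0⇒≡ p)))
∈-meet {x = true ∷ x}  {false ∷ y} {false ∷ v} _ (s≤s p) q = here (cong (false ∷_) (sym (hamming≤0⇒≡ p)))
∈-meet {x = true ∷ x}  {false ∷ y} {true ∷ v}  _ p (s≤s q) = there (here (cong (true ∷_) (sym (hamming≤0⇒≡ q))))

close-of-common : ∀ {m} (x y : Word m) {v} → hamming x v ≤ 1 → hamming y v ≤ 1 → Close x y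
close-of-common x y {v} xv yv =
  ≤-trans (hamming-triangle x v y) (+-mono-≤ xv (subst (_≤ 1) (hamming-sym y v) yv))

-- Covered and uncovered points of a ball

Covers : ∀ {m} → List (Word m) → Word m → Set
Covers X v = Any (λ x → hamming x v ≤ 1) X

covers? : ∀ {m} (X : List (Word m)) v → Dec (Covers X v)
covers? X v = any? (λ x → hamming x v ≤? 1) X

-- In set notation this is the part of N[x] outside N[Y], as `Covers Y v` means that v lies in N[Y].
uncovered : ∀ {m} → Word m → List (Word m) → List (Word m)
uncovered x Y = filter (λ v → ¬? (covers? Y v)) (ball x)

∈-uncovered⇒hamming≤1 : ∀ {m} {x : Word m} {Y v} → v ∈ uncovered x Y → hamming x v ≤ 1
∈-uncovered⇒hamming≤1 {Y = Y} v∈ = ∈-ball⇒hamming≤1 (proj₁ (∈-filter⁻ (λ v → ¬? (covers? Y v)) v∈))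

∈-uncovered⇒¬Covers : ∀ {m} {x : Word m} {Y v} → v ∈ uncovered x Y → ¬ Covers Y v
∈-uncovered⇒¬Covers {x = x} {Y} v∈ = proj₂ (∈-filter⁻ (λ v → ¬? (covers? Y v)) {xs = ball x} v∈)

uncovered-unique : ∀ {m} (x : Word m) Y → Unique (uncovered x Y)
uncovered-unique x Y = Uniqueₚ.filter⁺ (λ v → ¬? (covers? Y v)) (ball-unique x)

-- Points of the first list lie in N[x] and so in N[X], which the second list avoids. Hence the
-- lengths of such lists may be added when both lie in one set.
uncovered-disjoint : ∀ {m} {X Y : List (Word m)} {x y} → x ∈ X → y ∈ Y → Disjoint (uncovered x Y) (uncovered y X)
uncovered-disjoint {X = X} {Y} x∈X y∈Y (v∈₁ , v∈₂) =
  ∈-uncovered⇒¬Covers {Y = X} v∈₂ (lose x∈X (∈-uncovered⇒hamming≤1 {Y = Y} v∈₁))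

-- Every y ∈ Y covers at most two points of the ball around x; K accounts for the points covered by the words in S.
ball-count : ∀ {m} {x : Word m} {Y S K} → Unique Y → Unique S → S ⊆ Y → x ∉ Y →
  (∀ {s v} → s ∈ S → hamming x v ≤ 1 → hamming s v ≤ 1 → v ∈ K) →
  suc m + length S * 2 ≤ length (uncovered x Y) + length K + length Y * 2
ball-count {m} {x} {Y} {S} {K} uY uS S⊆Y x∉Y S-meets = begin
  suc m + s * 2                ≤⟨ +-monoˡ-≤ (s * 2) count ⟩
  (u + (k + r * 2)) + s * 2    ≡⟨ solve u k r s ⟩
  -- In `count` the words of `rest` contribute 2 each and those of `S` only through `K`. Adding
  -- `s * 2` to both sides brings in the length of `Y` without subtraction.
  (u + k) + (s + r) * 2        ≤⟨ +-monoʳ-≤ (u + k) (*-monoˡ-≤ 2 rest-count) ⟩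
  (u + k) + length Y * 2       ∎
  where
  open ≤-Reasoning
  open import Data.List.Membership.DecPropositional (_≟_ {m}) using (_∈?_)
  notS? = λ v → ¬? (v ∈? S)
  rest = filter notS? Y
  u = length (uncovered x Y)
  k = length K
  s = length S
  r = length rest

  solve : ∀ u k r s → (u + (k + r * 2)) + s * 2 ≡ (u + k) + (s + r) * 2
  solve = solve-∀

  S++rest⊆Y : S ++ rest ⊆ Y
  S++rest⊆Y v∈ with ∈-++⁻ S v∈
  ... | inj₁ v∈S = S⊆Y v∈S
  ... | inj₂ v∈rest = proj₁ (∈-filter⁻ notS? v∈rest)

  rest-count : s + r ≤ length Y
  rest-count = subst (_≤ length Y) (length-++ S)
    (unique-⊆⇒length≤ _≟_
      (Uniqueₚ.++⁺ uS (Uniqueₚ.filter⁺ notS? uY) λ (v∈S , v∈rest) → proj₂ (∈-filter⁻ notS? {xs = Y} v∈rest) v∈S)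
      S++rest⊆Y)

  ball⊆ : ball x ⊆ uncovered x Y ++ (K ++ concatMap (meet x) rest)
  ball⊆ {v} v∈ with covers? Y v
  ... | no ¬c = ∈-++⁺ˡ (∈-filter⁺ (λ v → ¬? (covers? Y v)) v∈ ¬c)
  ... | yes c with find c
  ... | y , y∈Y , yv with y ∈? S
  ... | yes y∈S = ∈-++⁺ʳ (uncovered x Y) (∈-++⁺ˡ (S-meets y∈S (∈-ball⇒hamming≤1 v∈) yv))
  ... | no y∉S = ∈-++⁺ʳ (uncovered x Y) (∈-++⁺ʳ K (∈-concatMap⁺ (meet x)
    (lose (∈-filter⁺ notS? y∈Y y∉S)
      (∈-meet (λ x≡y → x∉Y (subst (_∈ Y) (sym x≡y) y∈Y)) (∈-ball⇒hamming≤1 v∈) yv))))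

  count : suc m ≤ u + (k + r * 2)
  count = begin
    suc m                                                              ≡⟨ length-ball x ⟨
    length (ball x)                                                    ≤⟨ unique-⊆⇒length≤ _≟_ (ball-unique x) ball⊆ ⟩
    length (uncovered x Y ++ (K ++ concatMap (meet x) rest))           ≡⟨ length-++ (uncovered x Y) ⟩
    u + length (K ++ concatMap (meet x) rest)                          ≡⟨ cong (u +_) (length-++ K) ⟩
    u + (k + length (concatMap (meet x) rest))                         ≤⟨ +-monoʳ-≤ u (+-monoʳ-≤ k (length-concatMap (meet x) (length-meet x) rest)) ⟩
    u + (k + r * 2)                                                    ∎

-- The balls around x, a and b share a point, which need not be listed in K again.
∃-pair-meet : ∀ {m} {x a b : Word m} → x ≢ a → x ≢ b → a ≢ b →
  Close x a → Close x b → Close a b →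
  ∃ λ K → length K ≤ 1 ×
    (∀ {v} → hamming x v ≤ 1 → hamming b v ≤ 1 → hamming a v ≤ 1 ⊎ v ∈ K)
∃-pair-meet {x = x} {a} {b} x≢a x≢b a≢b xa xb ab
  with w , xw , aw , bw ← ∃-common-neighbour x≢a x≢b a≢b xa xb ab =
  remove _≟_ w (meet x b) ,
  ≤-pred (≤-trans (length-remove _≟_ (∈-meet x≢b xw bw)) (length-meet x b)) ,
  split
  where
  split : ∀ {v} → hamming x v ≤ 1 → hamming b v ≤ 1 → hamming a v ≤ 1 ⊎ v ∈ remove _≟_ w (meet x b)
  split {v} xv bv with v ≟ w
  ... | yes refl = inj₁ aw
  ... | no v≢w   = inj₂ (∈-filter⁺ (λ y → ¬? (y ≟ w)) (∈-meet x≢b xv bv) v≢w)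

-- Confused pairs and the one unit of slack

record Confused {m} (ℓ : ℕ) (D X Y : List (Word m)) : Set where
  field
    X-unique : Unique X
    Y-unique : Unique Y
    D-unique : Unique D
    |X|≤ℓ    : length X ≤ ℓ
    |Y|≤ℓ    : length Y ≤ ℓ
    -- `D` stands for the complement of the code; this is |D| ≤ m - 2ℓ + 2 without truncated
    -- subtraction.
    |D|-bound : length D + ℓ * 2 ≤ m + 2
    X⇒Y      : ∀ {v} → v ∉ D → Covers X v → Covers Y v
    Y⇒X      : ∀ {v} → v ∉ D → Covers Y v → Covers X v

open Confused

swap : ∀ {m ℓ} {D X Y : List (Word m)} → Confused ℓ D X Y → Confused ℓ D Y X
swap c = record
  { X-unique = Y-unique c ; Y-unique = X-unique c ; D-unique = D-unique c
  ; |X|≤ℓ = |Y|≤ℓ c ; |Y|≤ℓ = |X|≤ℓ c ; |D|-bound = |D|-bound c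
  ; X⇒Y = Y⇒X c ; Y⇒X = X⇒Y c }

module _ {m ℓ} {D X Y : List (Word m)} (c : Confused ℓ D X Y) {x} (x∈X : x ∈ X) (x∉Y : x ∉ Y) where

  open import Data.List.Membership.DecPropositional (_≟_ {m}) using (_∈?_)

  uncovered⊆D : uncovered x Y ⊆ D
  uncovered⊆D {v} v∈ = decidable-stable (v ∈? D) λ v∉D →
    ∈-uncovered⇒¬Covers {Y = Y} v∈ (X⇒Y c v∉D (lose x∈X (∈-uncovered⇒hamming≤1 {Y = Y} v∈)))

  |uncovered|≤|D| : length (uncovered x Y) ≤ length D
  |uncovered|≤|D| = unique-⊆⇒length≤ _≟_ (uncovered-unique x Y) uncovered⊆D

  -- The points of N[x] uncovered by `Y` lie in `D`, so `ball-count` can be combined with the bound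
  -- on |D|, and only one unit is left. The words of `S` are budgeted two points of N[x] each; a
  -- list `K` of all the points they cover may fall short of this by at most one.
  slack≤1 : ∀ {S K} → Unique S → S ⊆ Y →
    (∀ {s v} → s ∈ S → hamming x v ≤ 1 → hamming s v ≤ 1 → v ∈ K) → length S * 2 ≤ suc (length K)
  slack≤1 {S} {K} uS S⊆Y S-meets = +-cancelˡ-≤ (suc m) _ _ (begin
    suc m + length S * 2                                    ≤⟨ ball-count (Y-unique c) uS S⊆Y x∉Y S-meets ⟩
    length (uncovered x Y) + length K + length Y * 2        ≤⟨ +-mono-≤ (+-monoˡ-≤ (length K) |uncovered|≤|D|) (*-monoˡ-≤ 2 (|Y|≤ℓ c)) ⟩
    length D + length K + ℓ * 2                             ≡⟨ solve₁ (length D) (length K) (ℓ * 2) ⟩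
    length D + ℓ * 2 + length K                             ≤⟨ +-monoˡ-≤ (length K) (|D|-bound c) ⟩
    m + 2 + length K                                        ≡⟨ solve₂ m (length K) ⟩
    suc m + suc (length K)                                  ∎)
    where
    open ≤-Reasoning
    solve₁ : ∀ d k l → d + k + l ≡ d + l + k
    solve₁ = solve-∀
    solve₂ : ∀ m k → m + 2 + k ≡ suc m + suc k
    solve₂ = solve-∀

  -- A missing word of `Y` would cost two units, more than the slack.
  ℓ≤|Y| : ℓ ≤ length Y
  ℓ≤|Y| = ≮⇒≥ λ Y<ℓ → 1+n≰n {m + 2} (begin
    suc (m + 2)                                        ≡⟨ solve m ⟩
    suc m + 0 + 2                                      ≤⟨ +-monoˡ-≤ 2 (ball-count {S = []} {K = []} (Y-unique c) [] (λ ()) x∉Y (λ ())) ⟩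
    length (uncovered x Y) + 0 + length Y * 2 + 2      ≡⟨ solve′ (length (uncovered x Y)) (length Y) ⟩
    length (uncovered x Y) + suc (length Y) * 2        ≤⟨ +-mono-≤ |uncovered|≤|D| (*-monoˡ-≤ 2 Y<ℓ) ⟩
    length D + ℓ * 2                                   ≤⟨ |D|-bound c ⟩
    m + 2                                              ∎)
    where
    open ≤-Reasoning
    solve : ∀ m → suc (m + 2) ≡ suc m + 0 + 2
    solve = solve-∀
    solve′ : ∀ u y → u + 0 + y * 2 + 2 ≡ u + suc y * 2
    solve′ = solve-∀

  x≢ : ∀ {y} → y ∈ Y → x ≢ y
  x≢ y∈Y refl = x∉Y y∈Y

  -- A word at distance 3 or more covers nothing of N[x] and would waste its two units.
  all-close : ∀ {y} → y ∈ Y → Close x y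
  all-close {y} y∈Y with hamming x y ≤? 2
  ... | yes h = h
  ... | no ¬h = contradiction
    (slack≤1 {S = [ y ]} {K = []} ([] ∷ []) (λ { (here refl) → y∈Y })
      (λ { (here refl) xv yv → contradiction (close-of-common x y xv yv) ¬h }))
    λ { (s≤s ()) }

  -- All three words are close to `x`, so each close pair among them shares a point of N[x]. With
  -- two close pairs the three words would cover at most 2 + 1 + 1 = 4 of the budgeted 6 points, two
  -- short.
  no-cherry : ∀ {a b e} → a ∈ Y → b ∈ Y → e ∈ Y → a ≢ b → a ≢ e → b ≢ e →
    Close a b → ¬ Close b e
  no-cherry {a} {b} {e} a∈ b∈ e∈ a≢b a≢e b≢e ab be
    with ∃-pair-meet (x≢ a∈) (x≢ b∈) a≢b (all-close a∈) (all-close b∈) ab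
       | ∃-pair-meet (x≢ b∈) (x≢ e∈) b≢e (all-close b∈) (all-close e∈) be
  ... | K₁ , |K₁|≤1 , split₁ | K₂ , |K₂|≤1 , split₂ =
    <⇒≱ (s≤s |K|≤4) (slack≤1 {S = a ∷ b ∷ e ∷ []} {K = K}
      ((a≢b ∷ a≢e ∷ []) ∷ (b≢e ∷ []) ∷ [] ∷ [])
      (λ { (here refl) → a∈ ; (there (here refl)) → b∈ ; (there (there (here refl))) → e∈ })
      λ { (here refl) → in-a ; (there (here refl)) → in-b ; (there (there (here refl))) → in-e })
    where
    K = meet x a ++ (K₁ ++ K₂)
    |K|≤4 : suc (length K) ≤ 5
    |K|≤4 = s≤s (subst (_≤ 4) (sym (trans (length-++ (meet x a)) (cong (length (meet x a) +_) (length-++ K₁))))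
      (+-mono-≤ (length-meet x a) (+-mono-≤ |K₁|≤1 |K₂|≤1)))
    in-a : ∀ {v} → hamming x v ≤ 1 → hamming a v ≤ 1 → v ∈ K
    in-a xv av = ∈-++⁺ˡ (∈-meet (x≢ a∈) xv av)
    in-b : ∀ {v} → hamming x v ≤ 1 → hamming b v ≤ 1 → v ∈ K
    in-b xv bv with split₁ xv bv
    ... | inj₁ av = in-a xv av
    ... | inj₂ v∈K₁ = ∈-++⁺ʳ (meet x a) (∈-++⁺ˡ v∈K₁)
    in-e : ∀ {v} → hamming x v ≤ 1 → hamming e v ≤ 1 → v ∈ K
    in-e xv ev with split₂ xv ev
    ... | inj₁ bv = in-b xv bv
    ... | inj₂ v∈K₂ = ∈-++⁺ʳ (meet x a) (∈-++⁺ʳ K₁ v∈K₂)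

-- Exchanging X and Y; the case ℓ ≥ 3

module _ {m ℓ} {D X Y : List (Word m)} (c : Confused ℓ D X Y) where

  -- Since |X| ≤ ℓ ≤ |Y|, removing `x` leaves fewer words than `Y` has, so some word of `Y` is not
  -- among them; nor is it `x`. This makes every result available with `X` and `Y` exchanged.
  ∃-missing : ∀ {x} → x ∈ X → x ∉ Y → ∃ λ y → y ∈ Y × y ∉ X
  ∃-missing {x} x∈X x∉Y
    with y , y∈Y , y∉X-x ← ∃-fresh _≟_ {xs = remove _≟_ x X} (Y-unique c)
           (≤-trans (length-remove _≟_ x∈X) (≤-trans (|X|≤ℓ c) (ℓ≤|Y| c x∈X x∉Y))) =
    y , y∈Y , λ y∈X → y∉X-x (∈-filter⁺ (λ v → ¬? (v ≟ x)) y∈X λ { refl → x∉Y y∈Y })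

  module _ {x y} (x∈X : x ∈ X) (x∉Y : x ∉ Y) (y∈Y : y ∈ Y) (y∉X : y ∉ X) where

    -- Suppose `z` lies in both. Then `y` is close to `z`, and `Y` has a third word `e`. If `e` is
    -- in `X`, it is close to `y`, and `z`, `y`, `e` form a cherry; if not, `e` is close to `z`, and
    -- `y`, `z`, `e` form one.
    X-disjoint-Y : 3 ≤ ℓ → ∀ {z} → z ∈ X → z ∉ Y
    X-disjoint-Y 3≤ℓ {z} z∈X z∈Y
      with e , e∈Y , e∉ ← ∃-fresh _≟_ {xs = y ∷ z ∷ []} (Y-unique c) (≤-trans 3≤ℓ (ℓ≤|Y| c x∈X x∉Y)) =
      conclude (any? (e ≟_) X)
      where
      yz = all-close (swap c) y∈Y y∉X z∈X
      y≢z = λ { refl → y∉X z∈X }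
      y≢e = λ y≡e → e∉ (here (sym y≡e))
      z≢e = λ z≡e → e∉ (there (here (sym z≡e)))
      conclude : Dec (e ∈ X) → ⊥
      conclude (yes e∈X) = no-cherry c x∈X x∉Y z∈Y y∈Y e∈Y (y≢z ∘ sym) z≢e y≢e
        (close-sym y z yz) (all-close (swap c) y∈Y y∉X e∈X)
      conclude (no e∉X) = no-cherry c x∈X x∉Y y∈Y z∈Y e∈Y y≢z y≢e z≢e
        yz (close-sym e z (all-close (swap c) e∈Y e∉X z∈X))

    -- Among three words of `Y`, one of them cannot be close to both others.
    ∃-far-pair : 3 ≤ ℓ → ∃ λ y₁ → ∃ λ y₂ → y₁ ∈ Y × y₂ ∈ Y × ¬ Close y₁ y₂
    ∃-far-pair 3≤ℓ
      with y₁ , y₁∈ , y₁∉ ← ∃-fresh _≟_ {xs = [ y ]} (Y-unique c) (≤-trans (s≤s (s≤s z≤n)) (≤-trans 3≤ℓ (ℓ≤|Y| c x∈X x∉Y)))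
      with y₂ , y₂∈ , y₂∉ ← ∃-fresh _≟_ {xs = y ∷ y₁ ∷ []} (Y-unique c) (≤-trans 3≤ℓ (ℓ≤|Y| c x∈X x∉Y))
      with hamming y₁ y ≤? 2
    ... | no far = y₁ , y , y₁∈ , y∈Y , far
    ... | yes close = y , y₂ , y∈Y , y₂∈ ,
      no-cherry c x∈X x∉Y y₁∈ y∈Y y₂∈ (y₁∉ ∘ here) (λ e → y₂∉ (there (here (sym e)))) (λ e → y₂∉ (here (sym e))) close

    -- By `no-cherry` at most one of the three pairs among three words of `Y` is close; a word
    -- outside such a pair is far from the other two.
    ∃-far-from-two : 3 ≤ ℓ → ∃ λ y₁ → ∃ λ y₂ → ∃ λ y₃ → y₁ ∈ Y × y₂ ∈ Y × y₃ ∈ Y ×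
      y₂ ≢ y₃ × ¬ Close y₁ y₂ × ¬ Close y₁ y₃
    ∃-far-from-two 3≤ℓ
      with y₁ , y₁∈ , y₁∉ ← ∃-fresh _≟_ {xs = [ y ]} (Y-unique c) (≤-trans (s≤s (s≤s z≤n)) (≤-trans 3≤ℓ (ℓ≤|Y| c x∈X x∉Y)))
      with y₂ , y₂∈ , y₂∉ ← ∃-fresh _≟_ {xs = y ∷ y₁ ∷ []} (Y-unique c) (≤-trans 3≤ℓ (ℓ≤|Y| c x∈X x∉Y)) =
      conclude (hamming y y₁ ≤? 2) (hamming y y₂ ≤? 2)
      where
      y≢y₁ = λ e → y₁∉ (here (sym e))
      y≢y₂ = λ e → y₂∉ (here (sym e))
      y₁≢y₂ = λ e → y₂∉ (there (here (sym e)))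
      cherry-free : ∀ {a b e} → a ∈ Y → b ∈ Y → e ∈ Y → a ≢ b → a ≢ e → b ≢ e → Close a b → ¬ Close b e
      cherry-free = no-cherry c x∈X x∉Y
      conclude : Dec (Close y y₁) → Dec (Close y y₂) → _
      conclude (no far₁) (no far₂) = y , y₁ , y₂ , y∈Y , y₁∈ , y₂∈ , y₁≢y₂ , far₁ , far₂
      conclude (yes close₁) _ = y₂ , y , y₁ , y₂∈ , y∈Y , y₁∈ , y≢y₁ ,
        cherry-free y₁∈ y∈Y y₂∈ (y≢y₁ ∘ sym) y₁≢y₂ y≢y₂ (close-sym y y₁ close₁) ∘ close-sym y₂ y ,
        cherry-free y∈Y y₁∈ y₂∈ y≢y₁ y≢y₂ y₁≢y₂ close₁ ∘ close-sym y₂ y₁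
      conclude (no far₁) (yes close₂) = y₁ , y , y₂ , y₁∈ , y∈Y , y₂∈ , y≢y₂ ,
        far₁ ∘ close-sym y₁ y ,
        cherry-free y∈Y y₂∈ y₁∈ y≢y₂ y≢y₁ (y₁≢y₂ ∘ sym) close₂ ∘ close-sym y₁ y₂

confused-⊆-≥3 : ∀ {m ℓ} {D X Y : List (Word m)} → Confused ℓ D X Y → 3 ≤ ℓ →
  ∀ {x} → x ∈ X → x ∉ Y → ⊥
confused-⊆-≥3 {m} {X = X} {Y} c 3≤ℓ x∈X x∉Y =
  let y , y∈Y , y∉X = ∃-missing c x∈X x∉Y in
  contradict
    -- By disjointness every word of `Y` is outside `X`, so `all-close` covers all pairs between `Y`
    -- and `X`.
    (λ y∈ x∈ → all-close (swap c) y∈ (X-disjoint-Y (swap c) y∈Y y∉X x∈X x∉Y 3≤ℓ y∈) x∈)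
    (∃-far-pair (swap c) y∈Y y∉X x∈X x∉Y 3≤ℓ)
    (∃-far-from-two c x∈X x∉Y y∈Y y∉X 3≤ℓ)
  where
  contradict : (∀ {u v} → u ∈ Y → v ∈ X → Close u v) →
    (∃ λ x₁ → ∃ λ x₂ → x₁ ∈ X × x₂ ∈ X × ¬ Close x₁ x₂) →
    (∃ λ y₁ → ∃ λ y₂ → ∃ λ y₃ → y₁ ∈ Y × y₂ ∈ Y × y₃ ∈ Y × y₂ ≢ y₃ × ¬ Close y₁ y₂ × ¬ Close y₁ y₃) → ⊥
  contradict close (x₁ , x₂ , x₁∈ , x₂∈ , far) (y₁ , y₂ , y₃ , y₁∈ , y₂∈ , y₃∈ , y₂≢y₃ , far₂ , far₃) =
    y₂≢y₃ (trans (corner y₂∈ far₂) (sym (corner y₃∈ far₃)))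
    where
    corner : ∀ {y} → y ∈ Y → ¬ Close y₁ y → y ≡ y₁ ⊕ (x₁ ⊕ x₂)
    -- The quadrilateral has diagonals from `y₁` to `y` and from `x₁` to `x₂`; its sides join `Y` to
    -- `X` and are short.
    corner y∈ far-y = opposite-corner (close y₁∈ x₁∈) (close y₁∈ x₂∈) (close y∈ x₁∈) (close y∈ x₂∈) far-y far

-- The case ℓ = 2

|D|+2≤m : ∀ {m} {D X Y : List (Word m)} → Confused 2 D X Y → length D + 2 ≤ m
|D|+2≤m {m} {D} c = +-cancelʳ-≤ 2 _ _ (subst (_≤ m + 2) (sym (+-assoc (length D) 2 2)) (|D|-bound c))

module _ {m} {D X Y : List (Word m)} (c : Confused 2 D X Y) {x} (x∈X : x ∈ X) (x∉Y : x ∉ Y) where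

  -- Of the m + 1 points of N[x], two words of `Y` cover at most 4.
  m≤u+3 : m ≤ length (uncovered x Y) + 3
  m≤u+3 = ≤-pred (begin
    suc m                                          ≡⟨ +-identityʳ (suc m) ⟨
    suc m + 0                                      ≤⟨ ball-count {S = []} {K = []} (Y-unique c) [] (λ ()) x∉Y (λ ()) ⟩
    length (uncovered x Y) + 0 + length Y * 2      ≤⟨ +-monoʳ-≤ (length (uncovered x Y) + 0) (*-monoˡ-≤ 2 (|Y|≤ℓ c)) ⟩
    length (uncovered x Y) + 0 + 4                 ≡⟨ solve (length (uncovered x Y)) ⟩
    suc (length (uncovered x Y) + 3)               ∎)
    where
    open ≤-Reasoning
    solve : ∀ u → u + 0 + 4 ≡ suc (u + 3)
    solve = solve-∀

  -- A close pair shares a point of N[x], so it covers at most 3 points there instead of 4.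
  m≤u+2 : ∀ {a b} → a ∈ Y → b ∈ Y → a ≢ b → Close a b → m ≤ length (uncovered x Y) + 2
  m≤u+2 {a} {b} a∈ b∈ a≢b ab
    with K₁ , |K₁|≤1 , split ← ∃-pair-meet (x≢ c x∈X x∉Y a∈) (x≢ c x∈X x∉Y b∈) a≢b
           (all-close c x∈X x∉Y a∈) (all-close c x∈X x∉Y b∈) ab =
    +-cancelˡ-≤ 5 _ _ (begin
      5 + m                                                        ≡⟨ solve m ⟩
      suc m + 4                                                    ≤⟨ ball-count {S = a ∷ b ∷ []} {K = K} (Y-unique c)
                                                                        ((a≢b ∷ []) ∷ [] ∷ [])
                                                                        (λ { (here refl) → a∈ ; (there (here refl)) → b∈ }) x∉Y
                                                                        (λ { (here refl) → in-a ; (there (here refl)) → in-b }) ⟩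
      length (uncovered x Y) + length K + length Y * 2             ≤⟨ +-mono-≤ (+-monoʳ-≤ (length (uncovered x Y)) |K|≤3) (*-monoˡ-≤ 2 (|Y|≤ℓ c)) ⟩
      length (uncovered x Y) + 3 + 4                               ≡⟨ solve′ (length (uncovered x Y)) ⟩
      5 + (length (uncovered x Y) + 2)                             ∎)
    where
    open ≤-Reasoning
    K = meet x a ++ K₁
    |K|≤3 : length K ≤ 3
    |K|≤3 = subst (_≤ 3) (sym (length-++ (meet x a))) (+-mono-≤ (length-meet x a) |K₁|≤1)
    in-a : ∀ {v} → hamming x v ≤ 1 → hamming a v ≤ 1 → v ∈ K
    in-a xv av = ∈-++⁺ˡ (∈-meet (x≢ c x∈X x∉Y a∈) xv av)
    in-b : ∀ {v} → hamming x v ≤ 1 → hamming b v ≤ 1 → v ∈ K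
    in-b xv bv with split xv bv
    ... | inj₁ av = in-a xv av
    ... | inj₂ v∈K₁ = ∈-++⁺ʳ (meet x a) v∈K₁
    solve : ∀ m → 5 + m ≡ suc m + 4
    solve = solve-∀
    solve′ : ∀ u → u + 3 + 4 ≡ 5 + (u + 2)
    solve′ = solve-∀

  0<u : 4 ≤ m → 0 < length (uncovered x Y)
  0<u 4≤m = +-cancelʳ-≤ 3 _ _ (≤-trans 4≤m m≤u+3)

module _ {m} {D X Y : List (Word m)} (c : Confused 2 D X Y) (4≤m : 4 ≤ m) where

  -- With a close pair in `Y`, at least m - 2 points of N[x] stay uncovered, which already fills
  -- `D`. But `D` must also hold the uncovered points around `y`, which are disjoint from these and
  -- exist as m ≥ 4.
  no-close-pair : ∀ {x y a b} → x ∈ X → x ∉ Y → y ∈ Y → y ∉ X → a ∈ Y → b ∈ Y → a ≢ b → ¬ Close a b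
  no-close-pair {x} {y} x∈X x∉Y y∈Y y∉X a∈ b∈ a≢b ab = <⇒≱ (0<u (swap c) y∈Y y∉X 4≤m) (+-cancelˡ-≤ (u + 2) _ _ (begin
    (u + 2) + w                                      ≡⟨ solve u w ⟩
    (u + w) + 2                                      ≡⟨ cong (_+ 2) (length-++ (uncovered x Y)) ⟨
    length (uncovered x Y ++ uncovered y X) + 2      ≤⟨ +-monoˡ-≤ 2 (unique-⊆⇒length≤ _≟_
                                                          (Uniqueₚ.++⁺ (uncovered-unique x Y) (uncovered-unique y X) (uncovered-disjoint x∈X y∈Y)) both⊆D) ⟩
    length D + 2                                     ≤⟨ |D|+2≤m c ⟩
    m                                                ≤⟨ m≤u+2 c x∈X x∉Y a∈ b∈ a≢b ab ⟩
    u + 2                                            ≡⟨ +-identityʳ (u + 2) ⟨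
    (u + 2) + 0                                      ∎))
    where
    open ≤-Reasoning
    u = length (uncovered x Y)
    w = length (uncovered y X)
    solve : ∀ u w → (u + 2) + w ≡ (u + w) + 2
    solve = solve-∀
    both⊆D : uncovered x Y ++ uncovered y X ⊆ D
    both⊆D v∈ with ∈-++⁻ (uncovered x Y) v∈
    ... | inj₁ v∈₁ = uncovered⊆D c x∈X x∉Y v∈₁
    ... | inj₂ v∈₂ = uncovered⊆D (swap c) y∈Y y∉X v∈₂

module _ {m} {D X Y : List (Word m)} (c : Confused 2 D X Y) (4≤m : 4 ≤ m)
  {x x′ y} (x∈X : x ∈ X) (x∉Y : x ∉ Y) (x′∈X : x′ ∈ X) (x≢x′ : x ≢ x′) (y∈Y : y ∈ Y) (y∉X : y ∉ X) where

  private
    U = uncovered x Y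
    U′ = uncovered x′ Y
    W = uncovered y X

    x′∉Y : x′ ∉ Y
    -- As a word of `X`, `x′` is close to `y`; inside `Y` the two would be a close pair.
    x′∉Y x′∈Y = no-close-pair c 4≤m x∈X x∉Y y∈Y y∉X y∈Y x′∈Y (λ { refl → y∉X x′∈X })
      (all-close (swap c) y∈Y y∉X x′∈X)

    far : ¬ Close x x′
    far = no-close-pair (swap c) 4≤m y∈Y y∉X x∈X x∉Y x∈X x′∈X x≢x′

    unique : Unique (U ++ (U′ ++ W))
    unique = Uniqueₚ.++⁺ (uncovered-unique x Y)
      (Uniqueₚ.++⁺ (uncovered-unique x′ Y) (uncovered-unique y X) (uncovered-disjoint x′∈X y∈Y))
      λ (v∈U , v∈rest) → disjoint v∈U (∈-++⁻ U′ v∈rest)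
      where
      disjoint : ∀ {v} → v ∈ U → ¬ (v ∈ U′ ⊎ v ∈ W)
      disjoint v∈U (inj₁ v∈U′) =
        far (close-of-common x x′ (∈-uncovered⇒hamming≤1 {Y = Y} v∈U) (∈-uncovered⇒hamming≤1 {Y = Y} v∈U′))
      disjoint v∈U (inj₂ v∈W) = uncovered-disjoint x∈X y∈Y (v∈U , v∈W)

    all⊆D : U ++ (U′ ++ W) ⊆ D
    all⊆D v∈ with ∈-++⁻ U v∈
    ... | inj₁ v∈U = uncovered⊆D c x∈X x∉Y v∈U
    ... | inj₂ v∈rest with ∈-++⁻ U′ v∈rest
    ... | inj₁ v∈U′ = uncovered⊆D c x′∈X x′∉Y v∈U′
    ... | inj₂ v∈W = uncovered⊆D (swap c) y∈Y y∉X v∈W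

  -- The uncovered parts around `x`, `x′` and `y` are disjoint subsets of `D`. They have at least 1,
  -- 1 and m - 3 points, while |D| ≤ m - 2.
  second-word-absurd : ⊥
  second-word-absurd = <⇒≱ (+-mono-≤ (0<u c x∈X x∉Y 4≤m) (0<u c x′∈X x′∉Y 4≤m)) (+-cancelʳ-≤ (w + 2) _ _ (begin
    (u + u′) + (w + 2)            ≡⟨ solve u u′ w ⟩
    (u + (u′ + w)) + 2            ≡⟨ cong (_+ 2) (trans (length-++ U) (cong (u +_) (length-++ U′))) ⟨
    length (U ++ (U′ ++ W)) + 2   ≤⟨ +-monoˡ-≤ 2 (unique-⊆⇒length≤ _≟_ unique all⊆D) ⟩
    length D + 2                  ≤⟨ |D|+2≤m c ⟩
    m                             ≤⟨ m≤u+3 (swap c) y∈Y y∉X ⟩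
    w + 3                         ≡⟨ solve′ w ⟩
    1 + (w + 2)                   ∎))
    where
    open ≤-Reasoning
    u = length U
    u′ = length U′
    w = length W
    solve : ∀ u u′ w → (u + u′) + (w + 2) ≡ (u + (u′ + w)) + 2
    solve = solve-∀
    solve′ : ∀ w → w + 3 ≡ 1 + (w + 2)
    solve′ = solve-∀

confused-⊆-2 : ∀ {m} {D X Y : List (Word m)} → Confused 2 D X Y → 4 ≤ m →
  ∀ {x} → x ∈ X → x ∉ Y → ⊥
confused-⊆-2 c 4≤m {x} x∈X x∉Y =
  let y , y∈Y , y∉X = ∃-missing c x∈X x∉Y
      -- With the roles exchanged, `ℓ≤|Y|` gives `X` at least two words.
      x′ , x′∈X , x′∉ = ∃-fresh _≟_ {xs = [ x ]} (X-unique c) (ℓ≤|Y| (swap c) y∈Y y∉X)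
  in second-word-absurd c 4≤m x∈X x∉Y x′∈X (λ e → x′∉ (here (sym e))) y∈Y y∉X

-- Binary expansion as a bijection

decode : ∀ m → Fin (2 ^ m) → Word m
decode m i = bits (toℕ i) m

private
  bit : Bool → ℕ
  bit b = if b then 1 else 0

  bit<2 : ∀ b → bit b < 2
  bit<2 false = s≤s z≤n
  bit<2 true  = s≤s (s≤s z≤n)

-- The least significant bit comes first, matching `bits`, whose inverse this is.
value : ∀ {m} → Word m → ℕ
value []      = 0
value (b ∷ v) = bit b + value v * 2

value-bits : ∀ m {a} → a < 2 ^ m → value (bits a m) ≡ a
value-bits zero    (s≤s z≤n) = refl
value-bits (suc m) {a} a<2^m = begin
  bit (a % 2 ≡ᵇ 1) + value (bits (a / 2) m) * 2
    ≡⟨ cong₂ (λ b q → b + q * 2) (low-bit (m%n<n a 2)) (value-bits m (m<n*o⇒m/o<n (subst (a <_) (*-comm 2 (2 ^ m)) a<2^m))) ⟩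
  a % 2 + a / 2 * 2
    ≡⟨ m≡m%n+[m/n]*n a 2 ⟨
  a ∎
  where
  open ≡-Reasoning
  low-bit : ∀ {r} → r < 2 → bit (r ≡ᵇ 1) ≡ r
  low-bit {zero}        _ = refl
  low-bit {suc zero}    _ = refl
  low-bit {suc (suc _)} (s≤s (s≤s ()))

bits-value : ∀ {m} (v : Word m) → bits (value v) m ≡ v
bits-value [] = refl
bits-value {suc m} (b ∷ v) = cong₂ _∷_ low-bit (trans (cong (λ a → bits a m) high-bits) (bits-value v))
  where
  open ≡-Reasoning
  bit-≡ᵇ : ∀ b → (bit b ≡ᵇ 1) ≡ b
  bit-≡ᵇ false = refl
  bit-≡ᵇ true  = refl
  low-bit : ((bit b + value v * 2) % 2 ≡ᵇ 1) ≡ b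
  low-bit = begin
    (bit b + value v * 2) % 2 ≡ᵇ 1   ≡⟨ cong (_≡ᵇ 1) ([m+kn]%n≡m%n (bit b) (value v) 2) ⟩
    bit b % 2 ≡ᵇ 1                   ≡⟨ cong (_≡ᵇ 1) (m<n⇒m%n≡m (bit<2 b)) ⟩
    bit b ≡ᵇ 1                       ≡⟨ bit-≡ᵇ b ⟩
    b                                ∎
  high-bits : (bit b + value v * 2) / 2 ≡ value v
  high-bits = begin
    (bit b + value v * 2) / 2        ≡⟨ +-distrib-/-∣ʳ (bit b) (divides-refl (value v)) ⟩
    bit b / 2 + value v * 2 / 2      ≡⟨ cong₂ _+_ (m<n⇒m/n≡0 (bit<2 b)) (m*n/n≡m (value v) 2) ⟩
    value v                          ∎

value<2^m : ∀ {m} (v : Word m) → value v < 2 ^ m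
value<2^m [] = s≤s z≤n
value<2^m {suc m} (b ∷ v) = begin-strict
  bit b + value v * 2      <⟨ +-monoˡ-< (value v * 2) (bit<2 b) ⟩
  suc (value v) * 2        ≤⟨ *-monoˡ-≤ 2 (value<2^m v) ⟩
  2 ^ m * 2                ≡⟨ *-comm (2 ^ m) 2 ⟩
  2 ^ suc m                ∎
  where open ≤-Reasoning

encode : ∀ {m} → Word m → Fin (2 ^ m)
encode v = fromℕ< (value<2^m v)

decode-encode : ∀ {m} (v : Word m) → decode m (encode v) ≡ v
decode-encode {m} v = trans (cong (λ a → bits a m) (toℕ-fromℕ< (value<2^m v))) (bits-value v)

decode-injective : ∀ m {i j : Fin (2 ^ m)} → decode m i ≡ decode m j → i ≡ j
decode-injective m {i} {j} eq = toℕ-injective (begin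
  toℕ i                    ≡⟨ value-bits m (toℕ<n i) ⟨
  value (decode m i)     ≡⟨ cong value eq ⟩
  value (decode m j)     ≡⟨ value-bits m (toℕ<n j) ⟩
  toℕ j                    ∎)
  where open ≡-Reasoning

-- Subsets as duplicate-free lists of words

elements : ∀ {n} → Subset n → List (Fin n)
elements []          = []
elements (true ∷ p)  = zero ∷ map suc (elements p)
elements (false ∷ p) = map suc (elements p)

length-elements : ∀ {n} (p : Subset n) → length (elements p) ≡ ∣ p ∣
length-elements []          = refl
length-elements (true ∷ p)  = cong suc (trans (length-map suc (elements p)) (length-elements p))
length-elements (false ∷ p) = trans (length-map suc (elements p)) (length-elements p)

∈-elements⁺ : ∀ {n} {p : Subset n} {i} → i ∈ₛ p → i ∈ elements p
∈-elements⁺ {p = true ∷ p}  here        = here refl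
∈-elements⁺ {p = true ∷ p}  (there i∈p) = there (∈-map⁺ suc (∈-elements⁺ i∈p))
∈-elements⁺ {p = false ∷ p} (there i∈p) = ∈-map⁺ suc (∈-elements⁺ i∈p)

∈-elements⁻ : ∀ {n} {p : Subset n} {i} → i ∈ elements p → i ∈ₛ p
∈-elements⁻ {p = true ∷ p}  (here refl) = here
∈-elements⁻ {p = true ∷ p}  (there i∈) with _ , j∈ , refl ← ∈-map⁻ suc i∈ = there (∈-elements⁻ j∈)
∈-elements⁻ {p = false ∷ p} i∈ with _ , j∈ , refl ← ∈-map⁻ suc i∈ = there (∈-elements⁻ j∈)

elements-unique : ∀ {n} (p : Subset n) → Unique (elements p)
elements-unique []          = []
elements-unique (true ∷ p)  =
  tabulateAll (λ i∈ eq → 0∉ (subst (_∈ map suc (elements p)) (sym eq) i∈)) ∷ Uniqueₚ.map⁺ suc-injective (elements-unique p)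
  where
  0∉ : zero ∉ map suc (elements p)
  0∉ i∈ with ∈-map⁻ suc i∈
  ... | _ , _ , ()
elements-unique (false ∷ p) = Uniqueₚ.map⁺ suc-injective (elements-unique p)

words : ∀ {m} → Subset (2 ^ m) → List (Word m)
words {m} p = map (decode m) (elements p)

length-words : ∀ {m} (p : Subset (2 ^ m)) → length (words {m} p) ≡ ∣ p ∣
length-words {m} p = trans (length-map (decode m) (elements p)) (length-elements p)

words-unique : ∀ {m} (p : Subset (2 ^ m)) → Unique (words {m} p)
words-unique {m} p = Uniqueₚ.map⁺ (decode-injective m) (elements-unique p)

∈-words⁺ : ∀ {m} {p : Subset (2 ^ m)} {i} → i ∈ₛ p → decode m i ∈ words {m} p
∈-words⁺ {m} i∈p = ∈-map⁺ (decode m) (∈-elements⁺ i∈p)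

∈-words⁻ : ∀ {m} {p : Subset (2 ^ m)} {i} → decode m i ∈ words {m} p → i ∈ₛ p
∈-words⁻ {m} {p} {i} v∈ with j , j∈ , eq ← ∈-map⁻ (decode m) v∈ =
  subst (_∈ₛ p) (sym (decode-injective m eq)) (∈-elements⁻ j∈)

-- Closed neighbourhoods as covered points

∈N⇒Covers : ∀ {m} {X : Subset (2 ^ m)} {i} → i ∈N[ Hypercube m ] X → Covers (words {m} X) (decode m i)
∈N⇒Covers {m} (x , x∈X , inj₁ refl) = lose (∈-words⁺ {m} x∈X) (≤-trans (≤-reflexive (hamming-refl (decode m x))) z≤n)
∈N⇒Covers {m} (x , x∈X , inj₂ adj)  = lose (∈-words⁺ {m} x∈X) (≤-reflexive adj)

Covers⇒∈N : ∀ {m} {X : Subset (2 ^ m)} {i} → Covers (words {m} X) (decode m i) → i ∈N[ Hypercube m ] X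
Covers⇒∈N {m} {X} {i} c
  with v , v∈ , vi ← find c
  with x , x∈ , refl ← ∈-map⁻ (decode m) v∈ = x , ∈-elements⁻ x∈ , adjacent (m≤n⇒m<n∨m≡n vi)
  where
  adjacent : hamming (decode m x) (decode m i) < 1 ⊎ hamming (decode m x) (decode m i) ≡ 1 → x ≡ i ⊎ Hypercube m x i
  adjacent (inj₁ (s≤s d≤0)) = inj₁ (decode-injective m (hamming≤0⇒≡ {x = decode m x} {decode m i} d≤0))
  adjacent (inj₂ d≡1)       = inj₂ d≡1

-- The size of the complement, and the conclusion

n≤2^n : ∀ n → n ≤ 2 ^ n
n≤2^n zero    = z≤n
n≤2^n (suc n) = begin
  1 + n              ≤⟨ +-mono-≤ (m^n>0 2 n) (n≤2^n n) ⟩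
  2 ^ n + 2 ^ n      ≡⟨ cong (2 ^ n +_) (+-identityʳ (2 ^ n)) ⟨
  2 ^ suc n          ∎
  where open ≤-Reasoning

private
  -- The hypotheses make every truncated subtraction exact, so equality holds. With N = 2 ^ m the
  -- first two terms give the size of the complement of the code.
  complement-bound : ∀ {N m} ℓ → 1 ≤ ℓ → 2 * ℓ ∸ 2 ≤ m → m ≤ N →
    N ∸ (N ∸ m + (2 * ℓ ∸ 2)) + ℓ * 2 ≤ m + 2
  complement-bound {N} {m} ℓ 1≤ℓ k≤m m≤N = ≤-reflexive (begin
    N ∸ (N ∸ m + k) + ℓ * 2      ≡⟨ cong (_+ ℓ * 2) (∸-+-assoc N (N ∸ m) k) ⟨
    N ∸ (N ∸ m) ∸ k + ℓ * 2      ≡⟨ cong (λ a → a ∸ k + ℓ * 2) (m∸[m∸n]≡n m≤N) ⟩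
    m ∸ k + ℓ * 2                ≡⟨ cong (m ∸ k +_) (trans (*-comm ℓ 2) (sym (m∸n+n≡m (*-monoʳ-≤ 2 1≤ℓ)))) ⟩
    m ∸ k + (k + 2)              ≡⟨ +-assoc (m ∸ k) k 2 ⟨
    m ∸ k + k + 2                ≡⟨ cong (_+ 2) (m∸n+n≡m k≤m) ⟩
    m + 2                        ∎)
    where
    open ≡-Reasoning
    k = 2 * ℓ ∸ 2

confused-⊆ : ∀ {m ℓ} {D X Y : List (Word m)} → Confused ℓ D X Y → 2 ≤ ℓ → 4 ≤ m →
  ∀ {x} → x ∈ X → x ∉ Y → ⊥
confused-⊆ c 2≤ℓ 4≤m with m≤n⇒m<n∨m≡n 2≤ℓ
... | inj₁ 3≤ℓ  = confused-⊆-≥3 c 3≤ℓ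
... | inj₂ refl = confused-⊆-2 c 4≤m

theorem41 : (ℓ m : ℕ) → 2 ≤ ℓ → (2 * ℓ ∸ 2) ⊔ 4 ≤ m →
    InGr (2 ^ m) (2 ^ m ∸ m + (2 * ℓ ∸ 2)) ℓ (Hypercube m)
theorem41 ℓ m 2≤ℓ max≤m C |C|≡k X Y |X|≤ℓ |Y|≤ℓ X≢Y same =
  X≢Y (⊆-antisym (⊆-of confused) (⊆-of (swap confused)))
  where
  D = words {m} (∁ C)

  |D|≡ : length D ≡ 2 ^ m ∸ (2 ^ m ∸ m + (2 * ℓ ∸ 2))
  |D|≡ = trans (length-words {m} (∁ C)) (trans (∣∁p∣≡n∸∣p∣ C) (cong (2 ^ m ∸_) |C|≡k))

  transfer : ∀ {A B : Subset (2 ^ m)} →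
    (∀ i → i ∈ₛ C → i ∈N[ Hypercube m ] A → i ∈N[ Hypercube m ] B) →
    ∀ {v} → v ∉ D → Covers (words {m} A) v → Covers (words {m} B) v
  transfer {A} {B} A⇒B {v} v∉D cov =
    -- The assumption on neighbourhoods concerns indices, so `v` is replaced by `encode v`, which
    -- lies in `C` because `v` avoids `D`.
    subst (Covers (words {m} B)) (decode-encode v)
      (∈N⇒Covers {m} (A⇒B i i∈C (Covers⇒∈N {m} (subst (Covers (words {m} A)) (sym (decode-encode v)) cov))))
    where
    i = encode v
    i∈C : i ∈ₛ C
    i∈C = decidable-stable (i ∈ₛ? C) λ i∉C →
      v∉D (subst (_∈ D) (decode-encode v) (∈-words⁺ {m} (x∉p⇒x∈∁p i∉C)))

  confused : Confused ℓ D (words {m} X) (words {m} Y)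
  confused = record
    { X-unique  = words-unique {m} X
    ; Y-unique  = words-unique {m} Y
    ; D-unique  = words-unique {m} (∁ C)
    ; |X|≤ℓ     = subst (_≤ ℓ) (sym (length-words {m} X)) |X|≤ℓ
    ; |Y|≤ℓ     = subst (_≤ ℓ) (sym (length-words {m} Y)) |Y|≤ℓ
    ; |D|-bound = subst (λ d → d + ℓ * 2 ≤ m + 2) (sym |D|≡)
        (complement-bound ℓ (≤-trans (s≤s z≤n) 2≤ℓ) (≤-trans (m≤m⊔n (2 * ℓ ∸ 2) 4) max≤m) (n≤2^n m))
    ; X⇒Y       = transfer λ i i∈C → Equivalence.to (same i i∈C)
    ; Y⇒X       = transfer λ i i∈C → Equivalence.from (same i i∈C)
    }

  ⊆-of : ∀ {A B : Subset (2 ^ m)} → Confused ℓ D (words {m} A) (words {m} B) → ∀ {i} → i ∈ₛ A → i ∈ₛ B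
  ⊆-of {B = B} c {i} i∈A = decidable-stable (i ∈ₛ? B) λ i∉B →
    confused-⊆ c 2≤ℓ (≤-trans (m≤n⊔m (2 * ℓ ∸ 2) 4) max≤m) (∈-words⁺ {m} i∈A) (i∉B ∘ ∈-words⁻ {m})
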